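{- For every $k\geq1$ there is a bipartite graph $G$ such that $2\deg(G)\leq 2k\leq \mathrm{ca}(G)=t(G)$.
   Context: All graphs are finite and simple. The degeneracy $\deg(G)$ is the minimum, over all acyclic orientations of $G$, of the maximum out-degree. A caterpillar is a tree in which the non-leaf vertices form a path; a caterpillar forest is a disjoint union of caterpillars. The caterpillar arboricity $\mathrm{ca}(G)$ is the minimum number of caterpillar forests (subgraphs of $G$) whose edge sets cover $E(G)$. The track-number $t(G)$ is the minimum number of interval graphs (subgraphs of $G$, where an interval graph is the intersection graph of a finite family of intervals of the real line) whose edge sets cover $E(G)$. -}

module Defs where

open import Data.Nat using (ℕ; zero; suc; _+_; _*_; _≤_)
open import Data.Bool using (Bool; true; false; if_then_else_)
open import Data.Fin using (Fin; zero; suc; toℕ; inject₁; fromℕ)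
open import Data.Product using (Σ; ∃; ∃-syntax; _×_; _,_)
open import Data.Sum using (_⊎_)
open import Relation.Binary.PropositionalEquality using (_≡_; _≢_)
open import Relation.Nullary using (¬_)
open import Function.Definitions using (Injective)
open import Function.Bundles using (_⇔_)
import Data.Rational as ℚ

record Graph : Set where
  field
    n     : ℕ
    adj   : Fin n → Fin n → Bool
    sym   : ∀ u v → adj u v ≡ adj v u
    irr   : ∀ u → adj u u ≡ false
open Graph public

Bipartite : Graph → Set
Bipartite G = Σ (Fin (n G) → Bool) λ col →
  (∀ u v → adj G u v ≡ true → col u ≢ col v)

Subgraph : Graph → Set
Subgraph G = Σ (Fin (n G) → Fin (n G) → Bool) λ F →
  (∀ u v → F u v ≡ true → adj G u v ≡ true) × (∀ u v → F u v ≡ F v u)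

Covers : (G : Graph) (c : ℕ) → (Fin c → Subgraph G) → Set
Covers G c Fs = ∀ u v → adj G u v ≡ true →
  ∃[ i ] (Data.Product.proj₁ (Fs i) u v ≡ true)

count : ∀ {m} → (Fin m → Bool) → ℕ
count {zero}  p = 0
count {suc m} p = (if p zero then 1 else 0) + count (λ i → p (suc i))

IsOrientation : (G : Graph) → (Fin (n G) → Fin (n G) → Bool) → Set
IsOrientation G D =
  (∀ u v → adj G u v ≡ true → D u v ≡ true ⊎ D v u ≡ true) ×
  (∀ u v → D u v ≡ true → adj G u v ≡ true) ×
  (∀ u v → D u v ≡ true → D v u ≡ false)

data Path⁺ {m : ℕ} (D : Fin m → Fin m → Bool) : Fin m → Fin m → Set where
  one  : ∀ {u v} → D u v ≡ true → Path⁺ D u v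
  more : ∀ {u v w} → D u v ≡ true → Path⁺ D v w → Path⁺ D u w

IsAcyclicOrientation : (G : Graph) → (Fin (n G) → Fin (n G) → Bool) → Set
IsAcyclicOrientation G D = IsOrientation G D × (∀ u → ¬ Path⁺ D u u)

outdeg : ∀ {m} → (Fin m → Fin m → Bool) → Fin m → ℕ
outdeg D u = count (D u)

IsDegeneracy : Graph → ℕ → Set
IsDegeneracy G d =
  (∃[ D ] (IsAcyclicOrientation G D × (∀ u → outdeg D u ≤ d))) ×
  (∀ D d' → IsAcyclicOrientation G D → (∀ u → outdeg D u ≤ d') → d ≤ d')

module _ {m : ℕ} (F : Fin m → Fin m → Bool) where

  HasCycle : Set
  HasCycle = ∃[ k ] Σ (Fin (suc (suc (suc k))) → Fin m) λ p →
    Injective _≡_ _≡_ p ×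
    (∀ (i : Fin (suc (suc k))) → F (p (inject₁ i)) (p (suc i)) ≡ true) ×
    F (p (fromℕ (suc (suc k)))) (p zero) ≡ true

  IsForest : Set
  IsForest = ¬ HasCycle

  data Reach : Fin m → Fin m → Set where
    here : ∀ {u} → Reach u u
    step : ∀ {u v w} → F u v ≡ true → Reach v w → Reach u w

  NonLeaf : Fin m → Set
  NonLeaf u = ∃[ a ] ∃[ b ] (a ≢ b × F u a ≡ true × F u b ≡ true)

  -- the non-leaf vertices of the component of v induce a path
  -- (possibly empty, e.g. for the components K1 and K2)
  NonLeavesOfComponentFormPath : Fin m → Set
  NonLeavesOfComponentFormPath v = ∃[ k ] Σ (Fin k → Fin m) λ p →
    Injective _≡_ _≡_ p ×
    (∀ u → (Reach v u × NonLeaf u) ⇔ (∃[ i ] p i ≡ u)) ×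
    (∀ i j → (F (p i) (p j) ≡ true) ⇔
             (toℕ i ≡ suc (toℕ j) ⊎ toℕ j ≡ suc (toℕ i)))

  IsCaterpillarForest : Set
  IsCaterpillarForest = IsForest × (∀ v → NonLeavesOfComponentFormPath v)

  IsIntervalGraph : Set
  IsIntervalGraph = Σ (Fin m → ℚ.ℚ) λ l → Σ (Fin m → ℚ.ℚ) λ r →
    (∀ u → l u ℚ.≤ r u) ×
    (∀ u v → u ≢ v → (F u v ≡ true) ⇔ (l u ℚ.≤ r v × l v ℚ.≤ r u))

IsMinCover : (G : Graph) → ((Fin (n G) → Fin (n G) → Bool) → Set) → ℕ → Set
IsMinCover G P c =
  (∃[ Fs ] (Covers G c Fs × (∀ i → P (Data.Product.proj₁ (Fs i))))) ×
  (∀ c' (Fs : Fin c' → Subgraph G) → Covers G c' Fs →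
     (∀ i → P (Data.Product.proj₁ (Fs i))) → c ≤ c')

IsCaterpillarArboricity : Graph → ℕ → Set
IsCaterpillarArboricity G = IsMinCover G IsCaterpillarForest

IsTrackNumber : Graph → ℕ → Set
IsTrackNumber G = IsMinCover G IsIntervalGraph

{-# OPTIONS --safe #-}
module Submission where

-- The graph has parts A (k vertices), B (N vertices) and C, where every vertex of
-- B is joined to all of A and every k-tuple of vertices of B is joined to M
-- private vertices of C. Orienting C → B → A shows that it has degeneracy at most
-- k, and splitting the out-edges of every vertex covers it by 2k star forests,
-- which are both caterpillar forests and interval graphs.
--
-- Bipartite interval graphs and caterpillar forests contain neither a 4-cycle nor
-- the spider with three legs of length two. Suppose fewer than 2k such graphs
-- cover the edges. Many vertices b of B see the same colouring f of their edges to
-- A, and f is injective since there is no monochromatic 4-cycle. Cut them into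
-- blocks of k vertices. For the same reason some vertex of C joined to a block has
-- an injective colouring g of its edges. As k + k exceeds the number of colours, f
-- and g share a colour, which gives a monochromatic path a – b – c. Among 2k + 1
-- blocks three have the same end a, and these paths form a spider.

open import Defs
open import Data.Nat using (ℕ; _≤_; _*_)
open import Data.Product using (∃-syntax; _×_)
open import Relation.Binary.PropositionalEquality using (_≡_)

open import Data.Bool using (Bool; true; false; if_then_else_)
import Data.Bool.Properties as Bool
open import Data.Empty using (⊥; ⊥-elim)
open import Data.Fin as Fin using
  ( Fin; zero; suc; toℕ; inject₁; inject≤; fromℕ; combine; join; splitAt; finToFun; funToFin
  ; quotient; remQuot; _≟_)
import Data.Fin.Properties as Fin
import Data.Integer as ℤ
import Data.Integer.Properties as ℤ
open import Data.Nat using (zero; suc; z≤n; s≤s; _+_; _^_; _<_; _<?_)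
open import Data.Nat.Coprimality using (1-coprimeTo)
import Data.Nat.Coprimality as Coprimality
open import Data.Nat.Properties as ℕ using (≤-trans; ≤-refl)
open import Data.Product using (Σ; _,_; proj₁; proj₂)
import Data.Product as Product
import Data.Rational as ℚ
import Data.Rational.Properties as ℚ
open import Data.Sum using (_⊎_; inj₁; inj₂; swap; [_,_]′)
open import Function using (_∘_)
open import Function.Bundles using (_⇔_; mk⇔; Equivalence)
open import Function.Definitions using (Injective)
open import Relation.Binary.PropositionalEquality using (_≢_; refl; trans; cong; subst; subst₂; ≢-sym)
import Relation.Binary.PropositionalEquality as ≡
open import Relation.Nullary using (¬_; Dec; yes; no; does; contradiction; ¬?; _×-dec_; _⊎-dec_)
open import Relation.Nullary.Decidable using (dec-true; dec-false; does-⇔)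

holds : ∀ {a} {A : Set a} (a? : Dec A) → does a? ≡ true → A
holds (yes a) _ = a

splitAt-injective : ∀ m {n} {i j : Fin (m + n)} → splitAt m i ≡ splitAt m j → i ≡ j
splitAt-injective m {n} eq = trans (≡.sym (Fin.join-splitAt m n _))
  (trans (cong (join m n) eq) (Fin.join-splitAt m n _))

-- Counting and pigeonholes

-- `count` is a bare recursive number; listing the counted elements bijectively turns bounds on it
-- into injections between `Fin` types.
record Enumeration {m} (p : Fin m → Bool) (c : ℕ) : Set where
  field
    elem      : Fin c → Fin m
    injective : Injective _≡_ _≡_ elem
    sound     : ∀ i → p (elem i) ≡ true
    index     : ∀ v → p v ≡ true → ∃[ i ] elem i ≡ v

enumerate : ∀ {m} (p : Fin m → Bool) → Enumeration p (count p)
enumerate {zero} p = record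
  { elem = λ () ; injective = λ { {()} } ; sound = λ () ; index = λ () }
enumerate {suc m} p with p zero in p₀ | enumerate (p ∘ suc)
... | true | rest = record
  { elem      = λ { zero → zero ; (suc i) → suc (elem i) }
  ; injective = λ { {zero}  {zero}  _  → refl
                  ; {suc i} {suc j} eq → cong suc (injective (Fin.suc-injective eq)) }
  ; sound     = λ { zero → p₀ ; (suc i) → sound i }
  ; index     = λ { zero _ → zero , refl
                  ; (suc v) pv → Product.map suc (cong suc) (index v pv) }
  }
  where open Enumeration rest
... | false | rest = record
  { elem      = suc ∘ elem
  ; injective = injective ∘ Fin.suc-injective
  ; sound     = sound
  ; index     = λ { zero pv → contradiction (trans (≡.sym pv) p₀) λ ()
                  ; (suc v) pv → Product.map₂ (cong suc) (index v pv) }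
  }
  where open Enumeration rest

count-≤ : ∀ {m k} (p : Fin m → Bool) (φ : Fin k → Fin m) →
          (∀ v → p v ≡ true → ∃[ x ] φ x ≡ v) → count p ≤ k
count-≤ p φ onto = Fin.injective⇒≤ {f = λ i → proj₁ (preimage i)} λ {i} {j} eq →
  injective (trans (≡.sym (proj₂ (preimage i)))
            (trans (cong φ eq) (proj₂ (preimage j))))
  where
  open Enumeration (enumerate p)
  preimage : ∀ i → ∃[ x ] φ x ≡ elem i
  preimage i = onto (elem i) (sound i)

≤-count : ∀ {m k} (p : Fin m → Bool) (φ : Fin k → Fin m) → Injective _≡_ _≡_ φ →
          (∀ x → p (φ x) ≡ true) → k ≤ count p
≤-count p φ φ-inj into = Fin.injective⇒≤ {f = λ x → proj₁ (position x)} λ {x} {y} eq →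
  φ-inj (trans (≡.sym (proj₂ (position x)))
        (trans (cong elem eq) (proj₂ (position y))))
  where
  open Enumeration (enumerate p)
  position : ∀ x → ∃[ i ] elem i ≡ φ x
  position x = index (φ x) (into x)

-- If every fibre of `h` had at most `q` elements, sending `j` to the pair of `h j` and its position
-- in that fibre would inject `Fin n` into `Fin (p * q)`.
generalised-pigeonhole : ∀ {p q n} → p * q < n → (h : Fin n → Fin p) →
             ∃[ i ] Σ (Fin (suc q) → Fin n) λ e →
               Injective _≡_ _≡_ e × (∀ j → h (e j) ≡ i)
generalised-pigeonhole {p} {q} {n} pq<n h with Fin.any? (λ i → q <? count (λ j → does (h j ≟ i)))
... | yes (i , q<c) = i , (λ j → elem (inject≤ j q<c)) ,
        (λ eq → Fin.inject≤-injective q<c q<c _ _ (injective eq)) ,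
        λ j → holds (_ ≟ _) (sound (inject≤ j q<c))
  where open Enumeration (enumerate (λ j → does (h j ≟ i)))
... | no small = contradiction pq<n (ℕ.≤⇒≯ (Fin.injective⇒≤ {f = code} code-injective))
  where
  open module E i = Enumeration (enumerate (λ j → does (h j ≟ i)))
  small′ : ∀ i → count (λ j → does (h j ≟ i)) ≤ q
  small′ i = ℕ.≮⇒≥ (λ q<c → small (i , q<c))
  position : ∀ j → ∃[ x ] elem (h j) x ≡ j
  position j = index (h j) j (dec-true (h j ≟ h j) refl)
  code : Fin n → Fin (p * q)
  code j = combine (h j) (inject≤ (proj₁ (position j)) (small′ (h j)))
  -- `h j` is not a variable, so the equality of fibres is abstracted to `i ≡ i′` and matched before
  -- positions are compared.
  same : ∀ {i i′} → i ≡ i′ → ∀ x x′ →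
         inject≤ x (small′ i) ≡ inject≤ x′ (small′ i′) → elem i x ≡ elem i′ x′
  same {i} refl x x′ eq = cong (elem i) (Fin.inject≤-injective (small′ i) (small′ i) x x′ eq)
  code-injective : Injective _≡_ _≡_ code
  code-injective {j} {j′} eq with heq , xeq ← Fin.combine-injective (h j) _ (h j′) _ eq =
    trans (≡.sym (proj₂ (position j)))
      (trans (same heq _ _ xeq) (proj₂ (position j′)))

-- Joining `f` and `g` to one map on `Fin (k + l)` forces a collision, and injectivity excludes one
-- within either half.
injections-meet : ∀ {c k l} → c < k + l → {f : Fin k → Fin c} {g : Fin l → Fin c} →
                  Injective _≡_ _≡_ f → Injective _≡_ _≡_ g → ∃[ a ] ∃[ x ] f a ≡ g x
injections-meet {k = k} c<k+l {f} {g} f-inj g-inj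
  with i , j , i<j , same ← Fin.pigeonhole c<k+l (λ i → [ f , g ]′ (splitAt k i))
  with splitAt k i in eqᵢ | splitAt k j in eqⱼ
... | inj₁ a | inj₂ x  = a , x , same
... | inj₂ x | inj₁ a  = a , x , ≡.sym same
... | inj₁ a | inj₁ a′ = contradiction (splitAt-injective k
        (trans eqᵢ (trans (cong inj₁ (f-inj same)) (≡.sym eqⱼ)))) (Fin.<⇒≢ i<j)
... | inj₂ x | inj₂ x′ = contradiction (splitAt-injective k
        (trans eqᵢ (trans (cong inj₂ (g-inj same)) (≡.sym eqⱼ)))) (Fin.<⇒≢ i<j)

-- Star forests

-- An idempotent map encodes a star forest: its fixed points are the centres and isolated vertices,
-- and every other vertex is a leaf attached to its image.
module StarForest {m : ℕ} (π : Fin m → Fin m) (π-idem : ∀ u → π (π u) ≡ π u) where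

  Star : Fin m → Fin m → Set
  Star u v = u ≢ v × (π u ≡ v ⊎ π v ≡ u)

  star? : ∀ u v → Dec (Star u v)
  star? u v = ¬? (u ≟ v) ×-dec (π u ≟ v ⊎-dec π v ≟ u)

  star : Fin m → Fin m → Bool
  star u v = does (star? u v)

  star-⇒ : ∀ {u v} → star u v ≡ true → Star u v
  star-⇒ = holds (star? _ _)

  star-⇐ : ∀ {u v} → Star u v → star u v ≡ true
  star-⇐ = dec-true (star? _ _)

  Star-sym : ∀ {u v} → Star u v → Star v u
  Star-sym = Product.map ≢-sym swap

  star-sym : ∀ u v → star u v ≡ star v u
  star-sym u v = does-⇔ (mk⇔ Star-sym Star-sym) (star? u v) (star? v u)

  root : ∀ {u v} → π u ≡ v → π v ≡ v
  root refl = π-idem _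

  Star-π : ∀ {u v} → Star u v → π u ≡ π v
  Star-π (_ , inj₁ πu≡v) = trans πu≡v (≡.sym (root πu≡v))
  Star-π (_ , inj₂ πv≡u) = trans (root πv≡u) (≡.sym πv≡u)

  Reach-π : ∀ {u v} → Reach star u v → π u ≡ π v
  Reach-π here       = refl
  Reach-π (step e r) = trans (Star-π (star-⇒ e)) (Reach-π r)

  leaf-neighbour : ∀ {u v} → π u ≢ u → Star u v → v ≡ π u
  leaf-neighbour _  (_ , inj₁ πu≡v) = ≡.sym πu≡v
  leaf-neighbour πu≢u (_ , inj₂ πv≡u) = contradiction (root πv≡u) πu≢u

  nonLeaf-root : ∀ {u} → NonLeaf star u → π u ≡ u
  nonLeaf-root {u} (a , b , a≢b , ua , ub) with π u ≟ u
  ... | yes πu≡u = πu≡u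
  ... | no  πu≢u = contradiction
    (trans (leaf-neighbour πu≢u (star-⇒ ua)) (≡.sym (leaf-neighbour πu≢u (star-⇒ ub)))) a≢b

  roots-not-adjacent : ∀ {u v} → π u ≡ u → π v ≡ v → ¬ Star u v
  roots-not-adjacent πu≡u _ (u≢v , inj₁ πu≡v) = u≢v (trans (≡.sym πu≡u) πu≡v)
  roots-not-adjacent _ πv≡v (u≢v , inj₂ πv≡u) = u≢v (trans (≡.sym πv≡u) πv≡v)

  -- Every vertex of a cycle has two neighbours and so is fixed by `π`, but two fixed points are
  -- never adjacent.
  star-isForest : IsForest star
  star-isForest (k , p , p-inj , path , closing) =
    roots-not-adjacent
      (nonLeaf-root (p (suc zero) , p (fromℕ (suc (suc k))) , (λ eq → 1≢last (p-inj eq)) ,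
                     path zero , trans (star-sym _ _) closing))
      (nonLeaf-root (p zero , p (suc (suc zero)) , (λ eq → 0≢2 (p-inj eq)) ,
                     trans (star-sym _ _) (path zero) , path (suc zero)))
      (star-⇒ (path zero))
    where
    1≢last : suc zero ≢ fromℕ (suc (suc k))
    1≢last ()
    0≢2 : zero ≢ suc (suc zero)
    0≢2 ()

  nonLeaf? : ∀ u → Dec (NonLeaf star u)
  nonLeaf? u = Fin.any? λ a → Fin.any? λ b →
    ¬? (a ≟ b) ×-dec (star u a Bool.≟ true ×-dec star u b Bool.≟ true)

  reach-root : ∀ v → Reach star v (π v)
  reach-root v with v ≟ π v
  ... | yes v≡πv = subst (Reach star v) v≡πv here
  ... | no  v≢πv = step (star-⇐ (v≢πv , inj₁ refl)) here

  -- A component contains exactly one fixed point of `π`, its only possible non-leaf, so the spine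
  -- has one vertex or none.
  star-isCaterpillarForest : IsCaterpillarForest star
  star-isCaterpillarForest = star-isForest , spine
    where
    spine-root : ∀ {v u} → Reach star v u → NonLeaf star u → π v ≡ u
    spine-root r nl = trans (Reach-π r) (nonLeaf-root nl)
    spine : ∀ v → NonLeavesOfComponentFormPath star v
    spine v with nonLeaf? (π v)
    ... | yes nl = 1 , (λ _ → π v) , (λ { {zero} {zero} _ → refl }) ,
      (λ u → mk⇔ (λ (r , nlu) → zero , spine-root r nlu)
                 (λ { (_ , refl) → reach-root v , nl })) ,
      λ { zero zero → mk⇔ (λ e → contradiction refl (proj₁ (star-⇒ e))) λ { (inj₁ ()) ; (inj₂ ()) } }
    ... | no ¬nl = 0 , (λ ()) , (λ { {()} }) ,
      (λ u → mk⇔ (λ (r , nlu) → contradiction (subst (NonLeaf star) (≡.sym (spine-root r nlu)) nlu) ¬nl)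
                 λ { (() , _) }) ,
      λ ()

  -- The star with centre r occupies the integers W r, …, W r + m: its centre
  -- takes all of them and each leaf u only the point W r + u.
  private
    W : ℕ
    W = suc m

    first last lo hi : Fin m → ℕ
    first u = if does (π u ≟ u) then 0 else toℕ u
    last  u = if does (π u ≟ u) then m else toℕ u
    lo u = W * toℕ (π u) + first u
    hi u = W * toℕ (π u) + last u

    first-root : ∀ {u} → π u ≡ u → first u ≡ 0
    first-root {u} eq rewrite dec-true (π u ≟ u) eq = refl

    last-root : ∀ {u} → π u ≡ u → last u ≡ m
    last-root {u} eq rewrite dec-true (π u ≟ u) eq = refl

    first-leaf : ∀ {u} → π u ≢ u → first u ≡ toℕ u
    first-leaf {u} eq rewrite dec-false (π u ≟ u) eq = refl

    last-leaf : ∀ {u} → π u ≢ u → last u ≡ toℕ u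
    last-leaf {u} eq rewrite dec-false (π u ≟ u) eq = refl

    toℕ≤m : ∀ (u : Fin m) → toℕ u ≤ m
    toℕ≤m u = ℕ.<⇒≤ (Fin.toℕ<n u)

    first≤m : ∀ u → first u ≤ m
    first≤m u with does (π u ≟ u)
    ... | true  = z≤n
    ... | false = toℕ≤m u

    last≤m : ∀ u → last u ≤ m
    last≤m u with does (π u ≟ u)
    ... | true  = ≤-refl
    ... | false = toℕ≤m u

    lo≤hi : ∀ u → lo u ≤ hi u
    lo≤hi u with does (π u ≟ u)
    ... | true  = ℕ.+-monoʳ-≤ (W * toℕ (π u)) z≤n
    ... | false = ≤-refl

    -- Since `last v ≤ m < W`, the blocks of distinct centres are disjoint and ordered like the
    -- centres.
    block-order : ∀ {u v} → lo u ≤ hi v → toℕ (π u) ≤ toℕ (π v)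
    block-order {u} {v} le = ℕ.≮⇒≥ λ πv<πu → ℕ.<⇒≱ (begin-strict
      W * toℕ (π v) + last v  <⟨ ℕ.+-monoʳ-< (W * toℕ (π v)) (s≤s (last≤m v)) ⟩
      W * toℕ (π v) + W       ≡⟨ ℕ.+-comm _ W ⟩
      W + W * toℕ (π v)       ≡⟨ ℕ.*-suc W (toℕ (π v)) ⟨
      W * suc (toℕ (π v))     ≤⟨ ℕ.*-monoʳ-≤ W πv<πu ⟩
      W * toℕ (π u)           ≤⟨ ℕ.m≤m+n _ _ ⟩
      W * toℕ (π u) + first u ∎) le
      where open ℕ.≤-Reasoning

    leaf-order : ∀ {u v} → π u ≡ π v → π u ≢ u → π v ≢ v → lo u ≤ hi v → toℕ u ≤ toℕ v
    leaf-order {u} {v} eq πu≢u πv≢v le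
      rewrite first-leaf πu≢u | last-leaf πv≢v | eq = ℕ.+-cancelˡ-≤ (W * toℕ (π v)) _ _ le

    meet-root : ∀ {u v} → π u ≡ v → lo u ≤ hi v × lo v ≤ hi u
    meet-root {u} refl
      rewrite first-root (π-idem u) | last-root (π-idem u) | π-idem u =
      ℕ.+-monoʳ-≤ (W * toℕ (π u)) (first≤m u) , ℕ.+-monoʳ-≤ (W * toℕ (π u)) z≤n

    star-meet : ∀ {u v} → Star u v → lo u ≤ hi v × lo v ≤ hi u
    star-meet (_ , inj₁ eq) = meet-root eq
    star-meet (_ , inj₂ eq) = Product.swap (meet-root eq)

    -- The two inequalities put `u` and `v` in one block. If neither is its centre, both are leaves,
    -- and distinct leaves occupy distinct points.
    meet-star : ∀ {u v} → u ≢ v → lo u ≤ hi v × lo v ≤ hi u → Star u v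
    meet-star {u} {v} u≢v (u≤v , v≤u) with π u ≟ v | π v ≟ u
    ... | yes πu≡v | _ = u≢v , inj₁ πu≡v
    ... | no _ | yes πv≡u = u≢v , inj₂ πv≡u
    ... | no πu≢v | no πv≢u = contradiction
          (Fin.toℕ-injective (ℕ.≤-antisym (leaf-order same πu≢u πv≢v u≤v)
                                          (leaf-order (≡.sym same) πv≢v πu≢u v≤u))) u≢v
      where
      same : π u ≡ π v
      same = Fin.toℕ-injective (ℕ.≤-antisym (block-order {u} {v} u≤v) (block-order {v} {u} v≤u))
      πu≢u : π u ≢ u
      πu≢u eq = πv≢u (trans (≡.sym same) eq)
      πv≢v : π v ≢ v
      πv≢v eq = πu≢v (trans same eq)

    fromℕ′ : ℕ → ℚ.ℚ
    fromℕ′ n = ℚ.mkℚ (ℤ.+ n) 0 (Coprimality.sym (1-coprimeTo n))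

    fromℕ′-mono : ∀ {a b} → a ≤ b → fromℕ′ a ℚ.≤ fromℕ′ b
    fromℕ′-mono {a} {b} a≤b = ℚ.*≤* (subst₂ ℤ._≤_
      (≡.sym (ℤ.*-identityʳ (ℤ.+ a))) (≡.sym (ℤ.*-identityʳ (ℤ.+ b))) (ℤ.+≤+ a≤b))

    fromℕ′-cancel : ∀ {a b} → fromℕ′ a ℚ.≤ fromℕ′ b → a ≤ b
    fromℕ′-cancel {a} {b} (ℚ.*≤* le) = ℤ.drop‿+≤+ (subst₂ ℤ._≤_
      (ℤ.*-identityʳ (ℤ.+ a)) (ℤ.*-identityʳ (ℤ.+ b)) le)

  star-isIntervalGraph : IsIntervalGraph star
  star-isIntervalGraph = fromℕ′ ∘ lo , fromℕ′ ∘ hi , (λ u → fromℕ′-mono (lo≤hi u)) ,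
    λ u v u≢v → mk⇔
      (λ e → Product.map fromℕ′-mono fromℕ′-mono (star-meet (star-⇒ e)))
      (λ le → star-⇐ (meet-star u≢v (Product.map fromℕ′-cancel fromℕ′-cancel le)))

-- Obstructions

module _ {m : ℕ} (F : Fin m → Fin m → Bool) where

  SquareFree : Set
  SquareFree = ∀ {a a′ b b′} → a ≢ a′ → b ≢ b′ →
    F a b ≡ true → F a b′ ≡ true → F a′ b ≡ true → F a′ b′ ≡ true → ⊥

  -- A spider is a centre with three legs of length two. The feet need not be
  -- distinct here: coinciding feet yield a square.
  SpiderFree : Set
  SpiderFree = ∀ {a} (b c : Fin 3 → Fin m) → Injective _≡_ _≡_ b →
    (∀ i → F a (b i) ≡ true) → (∀ i → F (b i) (c i) ≡ true) → (∀ i → c i ≢ a) → ⊥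

module Obstructions {m : ℕ} (F : Fin m → Fin m → Bool) (F-sym : ∀ u v → F u v ≡ F v u)
                    (col : Fin m → Bool) (proper : ∀ u v → F u v ≡ true → col u ≢ col v) where

  sym-true : ∀ {u v} → F u v ≡ true → F v u ≡ true
  sym-true = trans (F-sym _ _)

  edge-≢ : ∀ {u v} → F u v ≡ true → u ≢ v
  edge-≢ e refl = proper _ _ e refl

  third-colour : ∀ {x y z : Bool} → x ≢ y → y ≢ z → x ≡ z
  third-colour x≢y y≢z = trans (Bool.¬-not x≢y) (≡.sym (Bool.¬-not (≢-sym y≢z)))

  two-steps-non-adjacent : ∀ {u v w} → F u v ≡ true → F v w ≡ true → F u w ≢ true
  two-steps-non-adjacent uv vw uw = proper _ _ uw (third-colour (proper _ _ uv) (proper _ _ vw))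

  forest-squareFree : IsForest F → SquareFree F
  forest-squareFree acyclic {a} {a′} {b} {b′} a≢a′ b≢b′ ab ab′ a′b a′b′ =
    -- `HasCycle` counts vertices from three, so `1` stands for a cycle of length four.
    acyclic (1 , p , p-inj , path , sym-true ab′)
    where
    p : Fin 4 → Fin m
    p zero                   = a
    p (suc zero)             = b
    p (suc (suc zero))       = a′
    p (suc (suc (suc zero))) = b′
    path : ∀ i → F (p (inject₁ i)) (p (suc i)) ≡ true
    path zero             = ab
    path (suc zero)       = sym-true a′b
    path (suc (suc zero)) = a′b′
    p-inj : Injective _≡_ _≡_ p
    p-inj {zero}                   {zero}                   _  = refl
    p-inj {zero}                   {suc zero}               eq = contradiction eq (edge-≢ ab)
    p-inj {zero}                   {suc (suc zero)}         eq = contradiction eq a≢a′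
    p-inj {zero}                   {suc (suc (suc zero))}   eq = contradiction eq (edge-≢ ab′)
    p-inj {suc zero}               {zero}                   eq = contradiction (≡.sym eq) (edge-≢ ab)
    p-inj {suc zero}               {suc zero}               _  = refl
    p-inj {suc zero}               {suc (suc zero)}         eq = contradiction (≡.sym eq) (edge-≢ a′b)
    p-inj {suc zero}               {suc (suc (suc zero))}   eq = contradiction eq b≢b′
    p-inj {suc (suc zero)}         {zero}                   eq = contradiction (≡.sym eq) a≢a′
    p-inj {suc (suc zero)}         {suc zero}               eq = contradiction eq (edge-≢ a′b)
    p-inj {suc (suc zero)}         {suc (suc zero)}         _  = refl
    p-inj {suc (suc zero)}         {suc (suc (suc zero))}   eq = contradiction eq (edge-≢ a′b′)
    p-inj {suc (suc (suc zero))}   {zero}                   eq = contradiction (≡.sym eq) (edge-≢ ab′)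
    p-inj {suc (suc (suc zero))}   {suc zero}               eq = contradiction (≡.sym eq) b≢b′
    p-inj {suc (suc (suc zero))}   {suc (suc zero)}         eq = contradiction (≡.sym eq) (edge-≢ a′b′)
    p-inj {suc (suc (suc zero))}   {suc (suc (suc zero))}   _  = refl

  -- Each `f i` is the predecessor or the successor of `n`, so an injective `f` would inject three
  -- indices into two sides.
  no-three-neighbours : ∀ {n} (f : Fin 3 → ℕ) → Injective _≡_ _≡_ f →
                        (∀ i → n ≡ suc (f i) ⊎ f i ≡ suc n) → ⊥
  no-three-neighbours {n} f f-inj near = ℕ.<-irrefl refl (Fin.injective⇒≤ {f = side} side-inj)
    where
    side : Fin 3 → Fin 2
    side i = [ (λ _ → zero) , (λ _ → suc zero) ]′ (near i)
    side-inj : Injective _≡_ _≡_ side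
    side-inj {i} {j} eq with near i | near j
    ... | inj₁ x | inj₁ y = f-inj (ℕ.suc-injective (trans (≡.sym x) y))
    ... | inj₂ x | inj₂ y = f-inj (trans x (≡.sym y))
    ... | inj₁ _ | inj₂ _ = contradiction eq λ ()
    ... | inj₂ _ | inj₁ _ = contradiction eq λ ()

  -- The centre of a spider and its three neighbours are non-leaves, but a
  -- vertex of a path has at most two neighbours on it.
  caterpillar-spiderFree : IsCaterpillarForest F → SpiderFree F
  caterpillar-spiderFree (_ , spines) {a} b c b-inj ab bc c≢a
    with k , p , _ , spine , consecutive ← spines a =
    no-three-neighbours (λ i → toℕ (proj₁ (foot i)))
      (λ {i} {j} eq → b-inj (trans (≡.sym (proj₂ (foot i)))
        (trans (cong p (Fin.toℕ-injective eq)) (proj₂ (foot j)))))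
      (λ i → Equivalence.to (consecutive _ _)
        (subst₂ (λ u v → F u v ≡ true) (≡.sym (proj₂ centre)) (≡.sym (proj₂ (foot i))) (ab i)))
    where
    centre : ∃[ i ] p i ≡ a
    centre = Equivalence.to (spine a)
      (here , b zero , b (suc zero) , (λ eq → contradiction (b-inj eq) λ ()) , ab zero , ab (suc zero))
    foot : ∀ i → ∃[ j ] p j ≡ b i
    foot i = Equivalence.to (spine (b i))
      (step (ab i) here , a , c i , ≢-sym (c≢a i) , sym-true (ab i) , bc i)

  module _ (interval : IsIntervalGraph F) where
    private
      l r : Fin m → ℚ.ℚ
      l = proj₁ interval
      r = proj₁ (proj₂ interval)

      Meet Before : Fin m → Fin m → Set
      Meet u v = l u ℚ.≤ r v × l v ℚ.≤ r u
      Before u v = r u ℚ.< l v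

      edge-meet : ∀ {u v} → F u v ≡ true → Meet u v
      edge-meet e = Equivalence.to (proj₂ (proj₂ (proj₂ interval)) _ _ (edge-≢ e)) e

      meet-edge : ∀ {u v} → u ≢ v → Meet u v → F u v ≡ true
      meet-edge u≢v = Equivalence.from (proj₂ (proj₂ (proj₂ interval)) _ _ u≢v)

      separated : ∀ {u v} → u ≢ v → F u v ≢ true → Before u v ⊎ Before v u
      separated {u} {v} u≢v ¬uv with l u ℚ.≤? r v | l v ℚ.≤? r u
      ... | no u≰v | _ = inj₂ (ℚ.≰⇒> u≰v)
      ... | yes _ | no v≰u = inj₁ (ℚ.≰⇒> v≰u)
      ... | yes u≤v | yes v≤u = contradiction (meet-edge u≢v (u≤v , v≤u)) ¬uv

      -- `w` starts by the end of `u`, which precedes the start of `v`, and `w′` ends no earlier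
      -- than that start.
      across : ∀ {u v w w′} → Before u v → Meet u w → Meet v w′ → l w ℚ.≤ r w′
      across u<v uw vw′ = ℚ.≤-trans (proj₂ uw) (ℚ.≤-trans (ℚ.<⇒≤ u<v) (proj₁ vw′))

    -- Having the same colour, `a` and `a′` are disjoint. Both `b` and `b′` meet the two, hence
    -- contain the gap between them and are adjacent, although they too have the same colour.
    interval-squareFree : SquareFree F
    interval-squareFree a≢a′ b≢b′ ab ab′ a′b a′b′ =
      two-steps-non-adjacent (sym-true ab) ab′ (meet-edge b≢b′
        ([ (λ a<a′ → across a<a′ (edge-meet ab) (edge-meet a′b′) ,
                     across a<a′ (edge-meet ab′) (edge-meet a′b))
         , (λ a′<a → across a′<a (edge-meet a′b) (edge-meet ab′) ,
                     across a′<a (edge-meet a′b′) (edge-meet ab))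
         ]′ (separated a≢a′ (two-steps-non-adjacent ab (sym-true a′b)))))

    -- The centre meets all three of the disjoint intervals b i, so it contains
    -- the middle one and therefore meets the foot attached to it.
    interval-spiderFree : SpiderFree F
    interval-spiderFree {a} b c b-inj ab bc c≢a =
      -- Whichever way the three pairs are ordered, two of the comparisons chain, and their common
      -- member is the middle interval.
      [ (λ 0<1 → [ (λ 1<2 → middle 0<1 1<2)
                 , (λ 2<1 → [ (λ 0<2 → middle 0<2 2<1) , (λ 2<0 → middle 2<0 0<1) ]′ (sep i₀ i₂ λ ()))
                 ]′ (sep i₁ i₂ λ ()))
      , (λ 1<0 → [ (λ 1<2 → [ (λ 0<2 → middle 1<0 0<2) , (λ 2<0 → middle 1<2 2<0) ]′ (sep i₀ i₂ λ ()))
                 , (λ 2<1 → middle 2<1 1<0)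
                 ]′ (sep i₁ i₂ λ ()))
      ]′ (sep i₀ i₁ λ ())
      where
      i₀ i₁ i₂ : Fin 3
      i₀ = zero
      i₁ = suc zero
      i₂ = suc (suc zero)
      sep : ∀ i j → i ≢ j → Before (b i) (b j) ⊎ Before (b j) (b i)
      sep i j i≢j = separated (λ eq → i≢j (b-inj eq)) (two-steps-non-adjacent (sym-true (ab i)) (ab j))
      middle : ∀ {i j k} → Before (b i) (b j) → Before (b j) (b k) → ⊥
      middle {i} {j} {k} i<j j<k = two-steps-non-adjacent (ab j) (bc j)
        (meet-edge (≢-sym (c≢a j))
          ( across i<j (edge-meet (sym-true (ab i))) (edge-meet (bc j))
          , across j<k (edge-meet (bc j)) (edge-meet (sym-true (ab k)))))

-- The graph

-- There are `k * 2 + 1` blocks because each will choose one of the `k` vertices of A, and three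
-- blocks must agree.
blockVertices : ℕ → ℕ
blockVertices k = suc (k * 2) * k

-- The power bounds the number of colourings of `suc k′` edges with fewer than `2 * suc k′` colours.
-- The conditions on `N` serve the degeneracy and the choice of equally coloured vertices of B; the
-- one on `M` yields two equally coloured vertices of C.
module Construction (k′ N M : ℕ)
  (kk′<N : suc k′ * k′ < N)
  (N-large : (2 * suc k′) ^ suc k′ * blockVertices (suc k′) < N)
  (M-large : (2 * suc k′) ^ suc k′ < M) where

  k Q R : ℕ
  k = suc k′
  Q = blockVertices k
  R = N ^ k * M

  data Vertex : Set where
    A : Fin k → Vertex
    B : Fin N → Vertex
    C : Fin R → Vertex

  A-injective : ∀ {a a′} → A a ≡ A a′ → a ≡ a′
  A-injective refl = refl

  B-injective : ∀ {b b′} → B b ≡ B b′ → b ≡ b′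
  B-injective refl = refl

  C-injective : ∀ {r r′} → C r ≡ C r′ → r ≡ r′
  C-injective refl = refl

  order : ℕ
  order = k + (N + R)

  encode : Vertex → Fin order
  encode (A a) = join k (N + R) (inj₁ a)
  encode (B b) = join k (N + R) (inj₂ (join N R (inj₁ b)))
  encode (C r) = join k (N + R) (inj₂ (join N R (inj₂ r)))

  decode : Fin order → Vertex
  decode u = [ A , (λ w → [ B , C ]′ (splitAt N w)) ]′ (splitAt k u)

  decode-encode : ∀ x → decode (encode x) ≡ x
  decode-encode (A a) rewrite Fin.splitAt-join k (N + R) (inj₁ a) = refl
  decode-encode (B b) rewrite Fin.splitAt-join k (N + R) (inj₂ (join N R (inj₁ b)))
                            | Fin.splitAt-join N R (inj₁ b) = refl
  decode-encode (C r) rewrite Fin.splitAt-join k (N + R) (inj₂ (join N R (inj₂ r)))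
                            | Fin.splitAt-join N R (inj₂ r) = refl

  encode-decode : ∀ u → encode (decode u) ≡ u
  encode-decode u with splitAt k u | Fin.join-splitAt k (N + R) u
  ... | inj₁ a | eq = eq
  ... | inj₂ w | eq with splitAt N w | Fin.join-splitAt N R w
  ...   | inj₁ b | refl = eq
  ...   | inj₂ r | refl = eq

  encode-injective : ∀ {x y} → encode x ≡ encode y → x ≡ y
  encode-injective {x} {y} eq =
    trans (≡.sym (decode-encode x)) (trans (cong decode eq) (decode-encode y))

  abstract
    -- Vertices of C are pairs of a k-tuple of vertices of B, its neighbours, and a
    -- number below M.
    slot : Fin R → Fin k → Fin N
    slot r = finToFun (quotient M r)

    tuple : (Fin k → Fin N) → Fin M → Fin R
    tuple s j = combine (funToFin s) j

    slot-tuple : ∀ s j x → slot (tuple s j) x ≡ s x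
    slot-tuple s j x = trans
      (cong (λ q → finToFun (proj₁ q) x) (Fin.remQuot-combine (funToFin s) j))
      (Fin.finToFun-funToFin s x)

    tuple-injective : ∀ s j j′ → tuple s j ≡ tuple s j′ → j ≡ j′
    tuple-injective s j j′ = Fin.combine-injectiveʳ (funToFin s) j (funToFin s) j′

  hasSlot? : ∀ r b → Dec (∃[ x ] slot r x ≡ b)
  hasSlot? r b = Fin.any? λ x → slot r x ≟ b

  out : Vertex → Vertex → Bool
  out (B _) (A _) = true
  out (C r) (B b) = does (hasSlot? r b)
  out _     _     = false

  adjacent : Vertex → Vertex → Bool
  adjacent (A _) (B _) = true
  adjacent (B b) (C r) = out (C r) (B b)
  adjacent x     y     = out x y

  adjacent-sym : ∀ x y → adjacent x y ≡ adjacent y x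
  adjacent-sym (A _) (A _) = refl
  adjacent-sym (A _) (B _) = refl
  adjacent-sym (A _) (C _) = refl
  adjacent-sym (B _) (A _) = refl
  adjacent-sym (B _) (B _) = refl
  adjacent-sym (B _) (C _) = refl
  adjacent-sym (C _) (A _) = refl
  adjacent-sym (C _) (B _) = refl
  adjacent-sym (C _) (C _) = refl

  adjacent-irr : ∀ x → adjacent x x ≡ false
  adjacent-irr (A _) = refl
  adjacent-irr (B _) = refl
  adjacent-irr (C _) = refl

  G : Graph
  G = record
    { n   = order
    ; adj = λ u v → adjacent (decode u) (decode v)
    ; sym = λ u v → adjacent-sym (decode u) (decode v)
    ; irr = λ u → adjacent-irr (decode u)
    }

  colour : Vertex → Bool
  colour (A _) = false
  colour (B _) = true
  colour (C _) = false

  adjacent-colour : ∀ x y → adjacent x y ≡ true → colour x ≢ colour y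
  adjacent-colour (A _) (B _) _ ()
  adjacent-colour (B _) (A _) _ ()
  adjacent-colour (B _) (C _) _ ()
  adjacent-colour (C _) (B _) _ ()

  G-bipartite : Bipartite G
  G-bipartite = (λ u → colour (decode u)) , λ u v → adjacent-colour (decode u) (decode v)

  adj-encode : ∀ x y → adjacent x y ≡ true → adj G (encode x) (encode y) ≡ true
  adj-encode x y = subst₂ (λ x y → adjacent x y ≡ true)
    (≡.sym (decode-encode x)) (≡.sym (decode-encode y))

  -- Degeneracy

  -- A potential that drops along every edge of `out`; hence no directed path closes up.
  rank : Vertex → ℕ
  rank (A _) = 0
  rank (B _) = 1
  rank (C _) = 2

  out-rank : ∀ x y → out x y ≡ true → rank y < rank x
  out-rank (B _) (A _) _ = ≤-refl
  out-rank (C _) (B _) _ = ≤-refl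

  out-adjacent : ∀ x y → out x y ≡ true → adjacent x y ≡ true
  out-adjacent (B _) (A _) e = e
  out-adjacent (C _) (B _) e = e

  adjacent-out : ∀ x y → adjacent x y ≡ true → out x y ≡ true ⊎ out y x ≡ true
  adjacent-out (A _) (B _) e = inj₂ e
  adjacent-out (B _) (A _) e = inj₁ e
  adjacent-out (B _) (C _) e = inj₂ e
  adjacent-out (C _) (B _) e = inj₁ e

  orientation : Fin order → Fin order → Bool
  orientation u v = out (decode u) (decode v)

  path-rank : ∀ {u v} → Path⁺ orientation u v → rank (decode v) < rank (decode u)
  path-rank (one {u} {v} e)        = out-rank (decode u) (decode v) e
  path-rank (more {u} {v} {w} e p) = ℕ.<-trans (path-rank p) (out-rank (decode u) (decode v) e)

  orientation-acyclic : IsAcyclicOrientation G orientation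
  orientation-acyclic =
    ( (λ u v → adjacent-out (decode u) (decode v))
    , (λ u v → out-adjacent (decode u) (decode v))
    , (λ u v e → Bool.¬-not λ e′ → ℕ.<-asym (out-rank (decode u) (decode v) e)
                                            (out-rank (decode v) (decode u) e′)))
    , λ u p → ℕ.<-irrefl refl (path-rank p)

  outNeighbour : Vertex → Fin k → Vertex
  outNeighbour (C r) x = B (slot r x)
  outNeighbour _     x = A x

  out-outNeighbour : ∀ x y → out x y ≡ true → ∃[ i ] outNeighbour x i ≡ y
  out-outNeighbour (B _) (A a) _ = a , refl
  out-outNeighbour (C r) (B b) e = Product.map₂ (cong B) (holds (hasSlot? r b) e)

  -- Tuples may repeat vertices, so the `k` listed out-neighbours may coincide and give only an
  -- upper bound.
  outdeg-orientation : ∀ u → outdeg orientation u ≤ k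
  outdeg-orientation u = count-≤ (orientation u) (encode ∘ outNeighbour (decode u)) λ v e →
    Product.map₂ (λ eq → trans (cong encode eq) (encode-decode v))
                 (out-outNeighbour (decode u) (decode v) e)

  -- In the complete bipartite graph between A and B, either some vertex of B has
  -- all its k edges outgoing, or some vertex of A has k outgoing edges.
  k≤outdeg : ∀ D d → IsOrientation G D → (∀ u → outdeg D u ≤ d) → k ≤ d
  k≤outdeg D d (total , _) small
    with Fin.any? (λ b → Fin.all? λ a → D (encode (B b)) (encode (A a)) Bool.≟ true)
  ... | yes (b , all) = ≤-trans
          (≤-count (D (encode (B b))) (encode ∘ A) (λ eq → A-injective (encode-injective eq)) all)
          (small (encode (B b)))
  -- Here `k′` is `k - 1`, so the `suc k′` indices returned are `k` vertices of B with arcs from one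
  -- `a`.
  ... | no none = let a , e , e-inj , hits = generalised-pigeonhole {k} {k′} kk′<N (proj₁ ∘ incoming) in
      ≤-trans
        (≤-count (D (encode (A a))) (λ j → encode (B (e j)))
          (λ eq → e-inj (B-injective (encode-injective eq)))
          (λ j → subst (λ a → D (encode (A a)) (encode (B (e j))) ≡ true) (hits j)
                   (proj₂ (incoming (e j)))))
        (small (encode (A a)))
    where
    incoming : ∀ b → ∃[ a ] D (encode (A a)) (encode (B b)) ≡ true
    incoming b with a , ¬out ← Fin.¬∀⟶∃¬ k _ (λ a → D (encode (B b)) (encode (A a)) Bool.≟ true)
                                 (λ all → none (b , all)) =
      a , [ (λ e → e) , (λ e → contradiction e ¬out) ]′
            (total (encode (A a)) (encode (B b)) (adj-encode (A a) (B b) refl))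

  G-degeneracy : IsDegeneracy G k
  G-degeneracy = (orientation , orientation-acyclic , outdeg-orientation) ,
    λ D d (oriented , _) small → k≤outdeg D d oriented small

  -- Cover by 2k star forests

  -- The first component selects the level, B to A or C to B, and the second one out-neighbour.
  -- Handling one level at a time keeps every parent fixed, which makes the map idempotent and
  -- accounts for the factor 2.
  parent : Fin 2 × Fin k → Vertex → Vertex
  parent (zero     , x) (B _) = A x
  parent (suc zero , x) (C r) = B (slot r x)
  parent _              y     = y

  parent-idem : ∀ i x → parent i (parent i x) ≡ parent i x
  parent-idem (zero     , _) (A _) = refl
  parent-idem (zero     , _) (B _) = refl
  parent-idem (zero     , _) (C _) = refl
  parent-idem (suc zero , _) (A _) = refl
  parent-idem (suc zero , _) (B _) = refl
  parent-idem (suc zero , _) (C _) = refl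

  parent-out : ∀ i x → parent i x ≢ x → out x (parent i x) ≡ true
  parent-out (zero     , _) (A _) ne = contradiction refl ne
  parent-out (zero     , _) (B _) _  = refl
  parent-out (zero     , _) (C _) ne = contradiction refl ne
  parent-out (suc zero , _) (A _) ne = contradiction refl ne
  parent-out (suc zero , _) (B _) ne = contradiction refl ne
  parent-out (suc zero , x) (C r) _  = dec-true (hasSlot? r (slot r x)) (x , refl)

  out-parent : ∀ x y → out x y ≡ true → ∃[ i ] parent i x ≡ y
  out-parent (B _) (A a) _ = (zero , a) , refl
  out-parent (C r) (B b) e = Product.map (suc zero ,_) (cong B) (holds (hasSlot? r b) e)

  module Forest (i : Fin 2 × Fin k) = StarForest
    (λ u → encode (parent i (decode u)))
    (λ u → cong encode (trans (cong (parent i) (decode-encode _)) (parent-idem i (decode u))))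

  star-adj : ∀ i u v → Forest.Star i u v → adj G u v ≡ true
  star-adj i u v (u≢v , related) =
    [ parent-adj u≢v , (λ eq → trans (sym G u v) (parent-adj (≢-sym u≢v) eq)) ]′ related
    where
    parent-adj : ∀ {u v} → u ≢ v → encode (parent i (decode u)) ≡ v → adj G u v ≡ true
    parent-adj {u} u≢v refl = subst (λ y → adjacent (decode u) y ≡ true)
      (≡.sym (decode-encode (parent i (decode u))))
      (out-adjacent (decode u) _ (parent-out i (decode u) λ eq →
        u≢v (trans (≡.sym (encode-decode u)) (cong encode (≡.sym eq)))))

  forest : Fin 2 × Fin k → Subgraph G
  forest i = Forest.star i , (λ u v e → star-adj i u v (Forest.star-⇒ i e)) , Forest.star-sym i

  orientation-star : ∀ u v → orientation u v ≡ true → ∃[ i ] Forest.Star i u v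
  orientation-star u v e with i , eq ← out-parent (decode u) (decode v) e =
    i , (λ { refl → ℕ.<-irrefl refl (out-rank (decode u) (decode u) e) })
      , inj₁ (trans (cong encode eq) (encode-decode v))

  adj-star : ∀ u v → adj G u v ≡ true → ∃[ i ] Forest.Star i u v
  adj-star u v e with adjacent-out (decode u) (decode v) e
  ... | inj₁ uv = orientation-star u v uv
  ... | inj₂ vu = Product.map₂ (λ {i} → Forest.Star-sym i) (orientation-star v u vu)

  forests : Fin (2 * k) → Subgraph G
  forests j = forest (remQuot k j)

  forests-cover : Covers G (2 * k) forests
  forests-cover u v e with (i , x) , uv ← adj-star u v e =
    combine i x , subst (λ i → Forest.star i u v ≡ true)
      (≡.sym (Fin.remQuot-combine i x)) (Forest.star-⇐ (i , x) uv)

  -- Lower bound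

  module LowerBound (c : ℕ) (Fs : Fin c → Subgraph G) (covers : Covers G c Fs)
                    (squareFree : ∀ i → SquareFree (proj₁ (Fs i)))
                    (spiderFree : ∀ i → SpiderFree (proj₁ (Fs i)))
                    (c<2k : c < 2 * k) where

    Edge : Fin c → Vertex → Vertex → Set
    Edge i x y = proj₁ (Fs i) (encode x) (encode y) ≡ true

    square : ∀ {i x x′ y y′} → x ≢ x′ → y ≢ y′ →
             Edge i x y → Edge i x y′ → Edge i x′ y → Edge i x′ y′ → ⊥
    square {i} x≢x′ y≢y′ =
      squareFree i (λ eq → x≢x′ (encode-injective eq)) (λ eq → y≢y′ (encode-injective eq))

    covered : ∀ x y → adjacent x y ≡ true → ∃[ i ] Edge i x y
    covered x y e = covers _ _ (adj-encode x y e)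

    few-functions : c ^ k ≤ (2 * k) ^ k
    few-functions = ℕ.^-monoˡ-≤ k (ℕ.<⇒≤ c<2k)

    funToFin-injective : ∀ (f g : Fin k → Fin c) → funToFin f ≡ funToFin g → ∀ x → f x ≡ g x
    funToFin-injective f g eq x = trans (≡.sym (Fin.finToFun-funToFin f x))
      (trans (cong (λ z → finToFun z x) eq) (Fin.finToFun-funToFin g x))

    AB : Fin N → Fin k → Fin c
    AB b a = proj₁ (covered (A a) (B b) refl)

    abstract
      -- Colourings of the edges to A are coded as numbers below `c ^ k`, and more than `c ^ k * Q`
      -- vertices of B leave some `Q + 1` of them with one code.
      uniform : ∃[ φ ] Σ (Fin (suc Q) → Fin N) λ e →
                  Injective _≡_ _≡_ e × (∀ j → funToFin (AB (e j)) ≡ φ)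
      uniform = generalised-pigeonhole {c ^ k} {Q}
        (ℕ.≤-<-trans (ℕ.*-monoˡ-≤ Q few-functions) N-large) (funToFin ∘ AB)

    e : Fin (suc Q) → Fin N
    e = proj₁ (proj₂ uniform)

    e-injective : Injective _≡_ _≡_ e
    e-injective = proj₁ (proj₂ (proj₂ uniform))

    f : Fin k → Fin c
    f = AB (e zero)

    f-edge : ∀ j a → Edge (f a) (A a) (B (e j))
    f-edge j a = subst (λ i → Edge i (A a) (B (e j)))
      (funToFin-injective (AB (e j)) f (trans (proj₂ (proj₂ (proj₂ uniform)) j)
                                            (≡.sym (proj₂ (proj₂ (proj₂ uniform)) zero))) a)
      (proj₂ (covered (A a) (B (e j)) refl))

    -- All vertices `e j` see the colouring `f`, so if `a` and `a′` had one colour, they would form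
    -- a monochromatic square with two of them.
    f-injective : Injective _≡_ _≡_ f
    f-injective {a} {a′} eq with a ≟ a′
    ... | yes a≡a′ = a≡a′
    ... | no a≢a′ = ⊥-elim (square {f a} {A a} {A a′} {B (e zero)} {B (e (suc zero))}
          (λ q → a≢a′ (A-injective q)) (λ q → 0≢1 (e-injective (B-injective q)))
          (f-edge zero a) (f-edge (suc zero) a) (recolour zero) (recolour (suc zero)))
      where
      0≢1 : zero ≢ suc zero
      0≢1 ()
      recolour : ∀ j → Edge (f a) (A a′) (B (e j))
      recolour j = subst (λ i → Edge i (A a′) (B (e j))) (≡.sym eq) (f-edge j a′)

    block : Fin (suc (k * 2)) → Fin k → Fin N
    -- The pigeonhole supplies `Q + 1` vertices; `inject₁` passes over the last, leaving exactly `Q`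
    -- for the blocks.
    block t x = e (inject₁ (combine t x))

    block-injective : ∀ t t′ x x′ → block t x ≡ block t′ x′ → t ≡ t′ × x ≡ x′
    block-injective t t′ x x′ eq =
      Fin.combine-injective t x t′ x′ (Fin.inject₁-injective (e-injective eq))

    module Block (t : Fin (suc (k * 2))) where

      bc : ∀ j x → ∃[ i ] Edge i (B (block t x)) (C (tuple (block t) j))
      bc j x = covered (B (block t x)) (C (tuple (block t) j))
        (dec-true (hasSlot? _ _) (x , slot-tuple (block t) j x))

      BC : Fin M → Fin k → Fin c
      BC j x = proj₁ (bc j x)

      abstract
        -- `M` exceeds the number of colourings, so two vertices of C with this tuple are coloured
        -- alike. They are one side of the square that forces `g` to be injective.
        twins : ∃[ j ] ∃[ j′ ] (j Fin.< j′ × funToFin (BC j) ≡ funToFin (BC j′))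
        twins = Fin.pigeonhole (ℕ.≤-<-trans few-functions M-large) (funToFin ∘ BC)

      j₁ j₂ : Fin M
      j₁ = proj₁ twins
      j₂ = proj₁ (proj₂ twins)

      g : Fin k → Fin c
      g = BC j₁

      g-edge₁ : ∀ x → Edge (g x) (B (block t x)) (C (tuple (block t) j₁))
      g-edge₁ x = proj₂ (bc j₁ x)

      g-edge₂ : ∀ x → Edge (g x) (B (block t x)) (C (tuple (block t) j₂))
      g-edge₂ x = subst (λ i → Edge i (B (block t x)) (C (tuple (block t) j₂)))
        (≡.sym (funToFin-injective g (BC j₂) (proj₂ (proj₂ (proj₂ twins))) x)) (proj₂ (bc j₂ x))

      g-injective : Injective _≡_ _≡_ g
      g-injective {x} {x′} eq with x ≟ x′
      ... | yes x≡x′ = x≡x′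
      ... | no x≢x′ = ⊥-elim (square
            {g x} {B (block t x)} {B (block t x′)} {C (tuple (block t) j₁)} {C (tuple (block t) j₂)}
            (λ q → x≢x′ (proj₂ (block-injective t t x x′ (B-injective q))))
            (λ q → Fin.<⇒≢ (proj₁ (proj₂ (proj₂ twins))) (tuple-injective (block t) j₁ j₂ (C-injective q)))
            (g-edge₁ x) (g-edge₂ x)
            (subst (λ i → Edge i (B (block t x′)) (C (tuple (block t) j₁))) (≡.sym eq) (g-edge₁ x′))
            (subst (λ i → Edge i (B (block t x′)) (C (tuple (block t) j₂))) (≡.sym eq) (g-edge₂ x′)))

      abstract
        meeting : ∃[ a ] ∃[ x ] f a ≡ g x
        meeting = injections-meet
          -- `2 * k` unfolds to `k + (k + 0)`.
          (subst (c <_) (cong (k +_) (ℕ.+-identityʳ k)) c<2k)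
          (λ {a} {a′} → f-injective {a} {a′}) (λ {x} {x′} → g-injective {x} {x′})

      hip : Fin k
      hip = proj₁ meeting

      slotAt : Fin k
      slotAt = proj₁ (proj₂ meeting)

      knee : Vertex
      knee = B (block t slotAt)

      foot : Vertex
      foot = C (tuple (block t) j₁)

      shin : Edge (f hip) knee foot
      shin = subst (λ i → Edge i knee foot) (≡.sym (proj₂ (proj₂ meeting))) (g-edge₁ slotAt)

    open Block using (hip; slotAt; knee; foot; shin)

    impossible : ⊥
    impossible
      -- `k * 2 + 1` blocks with `k` possible hips give three with a common `a`. As `f` does not
      -- depend on the block, all three legs have the colour `f a`.
      with a , legs , legs-inj , same ← generalised-pigeonhole {k} {2} ≤-refl hip =
      spiderFree (f a) {encode (A a)} (λ i → encode (knee (legs i))) (λ i → encode (foot (legs i)))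
        (λ {i} {j} eq → legs-inj (proj₁ (block-injective
          (legs i) (legs j) (slotAt (legs i)) (slotAt (legs j))
          (B-injective (encode-injective {knee (legs i)} {knee (legs j)} eq)))))
        (λ i → f-edge (inject₁ (combine (legs i) (slotAt (legs i)))) a)
        (λ i → subst (λ a → Edge (f a) (knee (legs i)) (foot (legs i))) (same i) (shin (legs i)))
        (λ i eq → contradiction (encode-injective {foot (legs i)} {A a} eq) λ ())

  -- Caterpillar arboricity and track-number

  -- One argument serves both parameters: star forests lie in both classes, and the lower bound uses
  -- only the two obstructions.
  G-minCover : ∀ P → (∀ i → P (Forest.star i)) →
    (∀ (S : Subgraph G) → P (proj₁ S) → SquareFree (proj₁ S) × SpiderFree (proj₁ S)) →
    IsMinCover G P (2 * k)
  G-minCover P stars obstructions =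
    (forests , forests-cover , λ j → stars (remQuot k j)) ,
    λ c Fs covers Ps → ℕ.≮⇒≥ λ c<2k → LowerBound.impossible c Fs covers
      (λ i → proj₁ (obstructions (Fs i) (Ps i)))
      (λ i → proj₂ (obstructions (Fs i) (Ps i))) c<2k

  module SubgraphObstructions (S : Subgraph G) = Obstructions (proj₁ S) (proj₂ (proj₂ S))
    (proj₁ G-bipartite) (λ u v uv → proj₂ G-bipartite u v (proj₁ (proj₂ S) u v uv))

  G-caterpillarArboricity : IsCaterpillarArboricity G (2 * k)
  G-caterpillarArboricity = G-minCover IsCaterpillarForest Forest.star-isCaterpillarForest
    λ S cat → let open SubgraphObstructions S in
      (λ {a} → forest-squareFree (proj₁ cat) {a}) , caterpillar-spiderFree cat

  G-trackNumber : IsTrackNumber G (2 * k)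
  G-trackNumber = G-minCover IsIntervalGraph Forest.star-isIntervalGraph
    λ S int → let open SubgraphObstructions S in
      interval-squareFree int , interval-spiderFree int

theorem12 : ∀ (k : ℕ) → 1 ≤ k →
    ∃[ G ] (Bipartite G × ∃[ d ] ∃[ c ] ∃[ t ]
    (IsDegeneracy G d × IsCaterpillarArboricity G c × IsTrackNumber G t ×
    2 * d ≤ 2 * k × 2 * k ≤ c × c ≡ t))
theorem12 (suc k′) _ = G , G-bipartite , suc k′ , _ , _ ,
  G-degeneracy , G-caterpillarArboricity , G-trackNumber , ≤-refl , ≤-refl , refl
  where
  k functions vertices : ℕ
  k = suc k′
  functions = (2 * k) ^ k
  vertices = functions * blockVertices k
  -- `N` is one more than the sum of its two lower bounds, so it exceeds each; `M` exceeds its bound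
  -- by one.
  open Construction k′ (suc (vertices + k * k′)) (suc functions)
    (s≤s (ℕ.m≤n+m (k * k′) vertices)) (s≤s (ℕ.m≤m+n vertices (k * k′))) ≤-refl
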